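{- Let $G$ be a graph of order $n$. Then $$\sigma_1(G)+\sigma_1(\overline{G})\ \ge\ \frac{n(n-1)}{2},$$ with equality if and only if $G$ is isomorphic to $K_n$ or to $\overline{K_n}$.
   Context: All graphs are finite, simple and undirected, with nonempty vertex set; the order of a graph is its number of vertices. $\overline{G}$ denotes the complement of $G$ (same vertex set, two distinct vertices being adjacent in $\overline{G}$ iff they are not adjacent in $G$). $K_n$ is the complete graph on $n$ vertices, so $\overline{K_n}$ is the edgeless graph on $n$ vertices. A subset $S\subseteq V(G)$ is called a $1$-nearly independent vertex subset of $G$ if the subgraph of $G$ induced by $S$ contains exactly one edge; $\sigma_1(G)$ denotes the number of $1$-nearly independent vertex subsets of $G$. -}

module Defs where

open import Data.Fin.Base using (Fin)
open import Data.Fin.Permutation using (Permutation; _⟨$⟩ʳ_)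
open import Data.Fin.Properties using (_≟_; _<?_)
open import Data.Fin.Subset using (Side; Subset; inside; outside; _∈_)
open import Data.Fin.Subset.Properties using (_∈?_)
open import Data.List.Base
  using (List; []; _∷_; [_]; length; filter; allFin; cartesianProduct; cartesianProductWith)
import Data.List.Membership.Propositional as List
open import Data.List.Membership.Propositional.Properties using (∈-cartesianProductWith⁺)
open import Data.List.Relation.Unary.All using ([]; _∷_)
open import Data.List.Relation.Unary.AllPairs using ([]; _∷_)
open import Data.List.Relation.Unary.Any using (here; there)
open import Data.List.Relation.Unary.Unique.Propositional using (Unique)
open import Data.List.Relation.Unary.Unique.Propositional.Properties using (cartesianProductWith⁺)
open import Data.Nat.Base using (ℕ; zero; suc)
open import Data.Nat.Properties using () renaming (_≟_ to _≟ℕ_)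
open import Data.Product.Base using (_×_; _,_)
open import Data.Vec.Base using ([]; _∷_)
open import Data.Vec.Properties using (∷-injective)
open import Function.Bundles using (_⇔_)
open import Level using (0ℓ)
open import Relation.Binary.Core using (Rel)
open import Relation.Binary.Definitions using (Decidable; Irreflexive; Symmetric)
open import Relation.Binary.PropositionalEquality using (_≡_; _≢_; refl; sym)
open import Relation.Nullary.Decidable using (¬?; _×-dec_)
open import Relation.Nullary.Negation using (¬_)
import Relation.Unary as Unary

-- Decidability of adjacency is part of the data, so that subsets can be counted.
record Graph (n : ℕ) : Set₁ where
  infix 4 _~_ _~?_
  field
    _~_      : Rel (Fin n) 0ℓ
    ~-sym    : Symmetric _~_
    ~-irrefl : Irreflexive _≡_ _~_
    _~?_     : Decidable _~_

infix 4 _≅_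

record _≅_ {m n : ℕ} (G : Graph m) (H : Graph n) : Set where
  private
    module G = Graph G
    module H = Graph H
  field
    bijection : Permutation m n
    adjacency : ∀ u v → (u G.~ v) ⇔ ((bijection ⟨$⟩ʳ u) H.~ (bijection ⟨$⟩ʳ v))

complement : ∀ {n} → Graph n → Graph n
complement G = record
  { _~_      = λ u v → u ≢ v × ¬ (u ~ v)
  ; ~-sym    = λ (u≢v , u≁v) → (λ v≡u → u≢v (sym v≡u)) , (λ v~u → u≁v (~-sym v~u))
  ; ~-irrefl = λ u≡v (u≢v , _) → u≢v u≡v
  ; _~?_     = λ u v → ¬? (u ≟ v) ×-dec ¬? (u ~? v)
  }
  where open Graph G

K : (n : ℕ) → Graph n
K n = record
  { _~_      = _≢_
  ; ~-sym    = λ u≢v v≡u → u≢v (sym v≡u)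
  ; ~-irrefl = λ u≡v u≢v → u≢v u≡v
  ; _~?_     = λ u v → ¬? (u ≟ v)
  }

-- Each edge {u, v} is listed once, as the pair (u , v) with u < v.
edges : ∀ {n} → Graph n → List (Fin n × Fin n)
edges {n} G =
  filter (λ (u , v) → (u <? v) ×-dec (u ~? v)) (cartesianProduct (allFin n) (allFin n))
  where open Graph G

-- The edge set of the subgraph induced by S, whose vertex set is S.
inducedEdges : ∀ {n} → Graph n → Subset n → List (Fin n × Fin n)
inducedEdges G S = filter (λ (u , v) → (u ∈? S) ×-dec (v ∈? S)) (edges G)

OneNearlyIndependent : ∀ {n} → Graph n → Subset n → Set
OneNearlyIndependent G S = length (inducedEdges G S) ≡ 1

oneNearlyIndependent? : ∀ {n} (G : Graph n) → Unary.Decidable (OneNearlyIndependent G)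
oneNearlyIndependent? G S = length (inducedEdges G S) ≟ℕ 1

sides : List Side
sides = outside ∷ inside ∷ []

subsets : (n : ℕ) → List (Subset n)
subsets zero    = [ [] ]
subsets (suc n) = cartesianProductWith _∷_ sides (subsets n)

-- These two lemmas justify counting subsets by filtering `subsets n`.
subsets-complete : ∀ {n} (S : Subset n) → S List.∈ subsets n
subsets-complete [] = here refl
subsets-complete (outside ∷ S) =
  ∈-cartesianProductWith⁺ _∷_ {xs = sides} (here refl) (subsets-complete S)
subsets-complete (inside ∷ S) =
  ∈-cartesianProductWith⁺ _∷_ {xs = sides} (there (here refl)) (subsets-complete S)

subsets-unique : ∀ n → Unique (subsets n)
subsets-unique zero    = [] ∷ []
subsets-unique (suc n) =
  cartesianProductWith⁺ _∷_ ∷-injective (((λ ()) ∷ []) ∷ [] ∷ []) (subsets-unique n)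

σ₁ : ∀ {n} → Graph n → ℕ
σ₁ {n} G = length (filter (oneNearlyIndependent? G) (subsets n))

{-# OPTIONS --safe #-}

-- In a subset S of size k, the edges of G and of its complement together are all k C 2 pairs.
-- Since k C 2 is never 2, S cannot be 1-nearly independent for both graphs, and if k = 2 it is so
-- for exactly one of them. Hence σ₁ G + σ₁ (complement G) is n C 2 plus the number of exceptional
-- subsets, those of size ≠ 2 that are 1-nearly independent for G or for its complement. If G is
-- neither complete nor edgeless, some vertex w has both a neighbour u and a non-neighbour v, and
-- one of the two graphs has exactly one edge inside {w, u, v}.
module Submission where

open import Defs
open import Data.Nat using (ℕ; NonZero; _+_; _*_; _∸_; _/_; _≥_)
open import Data.Product using (_×_)
open import Data.Sum using (_⊎_)
open import Function.Bundles using (_⇔_)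
open import Relation.Binary.PropositionalEquality using (_≡_)

open import Data.Bool.Base using (true; false)
open import Data.Fin.Base as Fin using (Fin; zero; suc)
open import Data.Fin.Permutation as Permutation using (_⟨$⟩ʳ_)
import Data.Fin.Properties as Fin
open import Data.Fin.Subset using (Subset; inside; outside; _∈_; ∣_∣; _∪_; ⁅_⁆)
open import Data.Fin.Subset.Properties using (_∈?_; drop-there; ∣⁅x⁆∣≡1; x∈⁅x⁆; x∈p∪q⁺)
open import Data.List.Base using (List; []; _∷_; _++_; length; map; filter; tabulate; allFin; cartesianProduct)
open import Data.List.Membership.Propositional.Properties
  using (∈-filter⁺; ∈-length; ∈-allFin; ∈-cartesianProduct⁺)
open import Data.List.Properties
  using (filter-++; filter-none; filter-reject; filter-≐; length-++; map-cong; map-∘; map-tabulate;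
         ++-identityʳ)
import Data.List.Relation.Unary.All as All
open import Data.Nat.Base using (zero; suc; _≤_; _<_; z≤n; s≤s; z<s; s<s)
open import Data.Nat.Combinatorics using (_C_; nC1≡n; nCk+nC[k+1]≡[n+1]C[k+1]; k>n⇒nCk≡0)
open import Data.Nat.DivMod using (m*n/n≡m)
open import Data.Nat.ListAction using (sum)
open import Data.Nat.Properties
  using (_≟_; suc-injective; +-suc; +-comm; +-identityʳ; +-cancelˡ-≡; *-comm;
         *-distribʳ-+; *-distribˡ-+; +-mono-≤; m≤m+n; m≤n⇒m≤1+n; <⇒≢;
         ≤-reflexive; module ≤-Reasoning)
open import Data.Product.Base using (_,_; proj₁; ∃-syntax)
open import Data.Sum.Base using (inj₁; inj₂)
open import Data.Vec.Base using ([]; _∷_; here; there)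
open import Function.Base using (_∘_; id)
open import Function.Bundles using (Equivalence; Injection; mk⇔)
open import Function.Properties.Inverse using (↔⇒↣)
open import Relation.Binary.Definitions using (tri<; tri≈; tri>)
open import Relation.Binary.PropositionalEquality
  using (_≢_; refl; sym; trans; cong; cong₂; subst; module ≡-Reasoning)
open import Relation.Nullary.Decidable
  using (yes; no; does; ¬?; _×-dec_; _⊎-dec_; decidable-stable)
open import Relation.Nullary.Negation using (¬_; contradiction)
open import Relation.Unary using (Decidable)

-- Counting the elements of a list that satisfy a decidable predicate.

module _ {A : Set} where

  count : {P : A → Set} → Decidable P → List A → ℕ
  count P? xs = length (filter P? xs)

  count-≐ : {P Q : A → Set} (P? : Decidable P) (Q? : Decidable Q) →
            (∀ x → P x → Q x) → (∀ x → Q x → P x) → ∀ xs → count P? xs ≡ count Q? xs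
  count-≐ P? Q? P⊆Q Q⊆P xs = cong length (filter-≐ P? Q? ((λ {x} → P⊆Q x) , (λ {x} → Q⊆P x)) xs)

  count-none : {P : A → Set} (P? : Decidable P) → (∀ x → ¬ P x) → ∀ xs → count P? xs ≡ 0
  count-none P? ¬P xs = cong length (filter-none P? (All.universal ¬P xs))

  count-++ : {P : A → Set} (P? : Decidable P) → ∀ xs ys →
             count P? (xs ++ ys) ≡ count P? xs + count P? ys
  count-++ P? xs ys = trans (cong length (filter-++ P? xs ys)) (length-++ (filter P? xs))

  count-filter : {P Q : A → Set} (P? : Decidable P) (Q? : Decidable Q) → ∀ xs →
                 count Q? (filter P? xs) ≡ count (λ x → P? x ×-dec Q? x) xs
  count-filter P? Q? [] = refl
  count-filter P? Q? (x ∷ xs) with does (P? x)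
  ... | false = count-filter P? Q? xs
  ... | true with does (Q? x)
  ...   | false = count-filter P? Q? xs
  ...   | true  = cong suc (count-filter P? Q? xs)

  count-⊎ : {P Q : A → Set} (P? : Decidable P) (Q? : Decidable Q) → (∀ x → P x → ¬ Q x) → ∀ xs →
            count (λ x → P? x ⊎-dec Q? x) xs ≡ count P? xs + count Q? xs
  count-⊎ P? Q? disjoint [] = refl
  count-⊎ P? Q? disjoint (x ∷ xs) with P? x | Q? x
  ... | yes p | yes q = contradiction q (disjoint x p)
  ... | yes _ | no  _ = cong suc (count-⊎ P? Q? disjoint xs)
  ... | no  _ | yes _ = trans (cong suc (count-⊎ P? Q? disjoint xs)) (sym (+-suc _ _))
  ... | no  _ | no  _ = count-⊎ P? Q? disjoint xs

count-map : {A B : Set} {P : B → Set} (P? : Decidable P) (f : A → B) → ∀ xs →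
            count P? (map f xs) ≡ count (λ x → P? (f x)) xs
count-map P? f [] = refl
count-map P? f (x ∷ xs) with does (P? (f x))
... | false = count-map P? f xs
... | true  = cong suc (count-map P? f xs)

count-cartesianProduct : {A B : Set} {P : A × B → Set} (P? : Decidable P) → ∀ xs ys →
  count P? (cartesianProduct xs ys) ≡ sum (map (λ x → count (λ y → P? (x , y)) ys) xs)
count-cartesianProduct P? [] ys = refl
count-cartesianProduct P? (x ∷ xs) ys = trans
  (count-++ P? (map (x ,_) ys) (cartesianProduct xs ys))
  (cong₂ _+_ (count-map P? (x ,_) ys) (count-cartesianProduct P? xs ys))

allFin-suc : ∀ n → allFin (suc n) ≡ zero ∷ map suc (allFin n)
allFin-suc n = cong (zero ∷_) (sym (map-tabulate id suc))

count-allFin-suc : ∀ {n} {P : Fin (suc n) → Set} (P? : Decidable P) → ¬ P zero →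
                   count P? (allFin (suc n)) ≡ count (λ i → P? (suc i)) (allFin n)
count-allFin-suc {n} P? ¬P₀ = begin
  count P? (allFin (suc n))            ≡⟨ cong (count P?) (allFin-suc n) ⟩
  count P? (zero ∷ map suc (allFin n)) ≡⟨ cong length (filter-reject P? ¬P₀) ⟩
  count P? (map suc (allFin n))        ≡⟨ count-map P? suc (allFin n) ⟩
  count (λ i → P? (suc i)) (allFin n)  ∎
  where open ≡-Reasoning

-- Arithmetic of the triangular numbers `k C 2`.

suc-C2 : ∀ k → suc k C 2 ≡ k + k C 2
suc-C2 k = trans (sym (nCk+nC[k+1]≡[n+1]C[k+1] k 1)) (cong (_+ k C 2) (nC1≡n k))

-- The doubled form keeps truncated division out of the induction; `C2≡half` divides once at the
-- end.
C2*2 : ∀ k → (k C 2) * 2 ≡ k * (k ∸ 1)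
C2*2 zero          = refl
-- The case 1 stands apart so that the induction hypothesis is only taken at successors, where `∸ 1`
-- does not truncate.
C2*2 (suc zero)    = refl
C2*2 (suc (suc k)) = begin
  (suc (suc k) C 2) * 2       ≡⟨ cong (_* 2) (suc-C2 (suc k)) ⟩
  (suc k + suc k C 2) * 2     ≡⟨ *-distribʳ-+ 2 (suc k) (suc k C 2) ⟩
  suc k * 2 + (suc k C 2) * 2 ≡⟨ cong (suc k * 2 +_) (C2*2 (suc k)) ⟩
  suc k * 2 + suc k * k       ≡⟨ *-distribˡ-+ (suc k) 2 k ⟨
  suc k * suc (suc k)         ≡⟨ *-comm (suc k) (suc (suc k)) ⟩
  suc (suc k) * suc k         ∎
  where open ≡-Reasoning

C2≡half : ∀ n → n C 2 ≡ (n * (n ∸ 1)) / 2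
C2≡half n = trans (sym (m*n/n≡m (n C 2) 2)) (cong (_/ 2) (C2*2 n))

-- Two unfoldings of Pascal's rule give a summand at least 2 and another at least 1. As the earlier
-- values are 0, 0 and 1, the sequence `k C 2` jumps over 2 and takes the value 1 only at `k = 2`.
3≤[3+k]C2 : ∀ k → 3 ≤ suc (suc (suc k)) C 2
3≤[3+k]C2 k = begin
  2 + 1                                 ≤⟨ +-mono-≤ (m≤m+n 2 k) (m≤m+n 1 (k + suc k C 2)) ⟩
  suc (suc k) + (suc k + suc k C 2)     ≡⟨ cong (suc (suc k) +_) (suc-C2 (suc k)) ⟨
  suc (suc k) + suc (suc k) C 2         ≡⟨ suc-C2 (suc (suc k)) ⟨
  suc (suc (suc k)) C 2                 ∎
  where open ≤-Reasoning

C2≢2 : ∀ k → k C 2 ≢ 2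
C2≢2 (suc (suc (suc k))) eq = contradiction (subst (3 ≤_) eq (3≤[3+k]C2 k)) λ { (s≤s (s≤s ())) }

C2≡1⇒≡2 : ∀ k → k C 2 ≡ 1 → k ≡ 2
C2≡1⇒≡2 (suc (suc zero)) _ = refl
C2≡1⇒≡2 (suc (suc (suc k))) eq =
  contradiction (subst (3 ≤_) eq (3≤[3+k]C2 k)) λ { (s≤s ()) }

C2≤3 : ∀ {k} → k ≤ 3 → k C 2 ≤ 3
C2≤3 {0} _ = z≤n
C2≤3 {1} _ = z≤n
C2≤3 {2} _ = s≤s z≤n
C2≤3 {3} _ = s≤s (s≤s (s≤s z≤n))
C2≤3 {suc (suc (suc (suc _)))} (s≤s (s≤s (s≤s ())))

-- Subsets of a given size, and pairs inside a subset.

count-∣∣≡k : ∀ n k → count (λ S → ∣ S ∣ ≟ k) (subsets n) ≡ n C k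
count-∣∣≡k zero zero          = refl
count-∣∣≡k zero (suc k)       = sym (k>n⇒nCk≡0 {zero} {suc k} z<s)
count-∣∣≡k (suc n) k = begin
  count (λ S → ∣ S ∣ ≟ k) (map (outside ∷_) (subsets n) ++ (map (inside ∷_) (subsets n) ++ []))
    -- The product with the two-element list `sides` leaves a trailing `++ []`.
    ≡⟨ cong (λ Ss → count (λ S → ∣ S ∣ ≟ k) (map (outside ∷_) (subsets n) ++ Ss)) (++-identityʳ _) ⟩
  count (λ S → ∣ S ∣ ≟ k) (map (outside ∷_) (subsets n) ++ map (inside ∷_) (subsets n))
    ≡⟨ count-++ (λ S → ∣ S ∣ ≟ k) (map (outside ∷_) (subsets n)) (map (inside ∷_) (subsets n)) ⟩
  count (λ S → ∣ S ∣ ≟ k) (map (outside ∷_) (subsets n)) +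
  count (λ S → ∣ S ∣ ≟ k) (map (inside ∷_) (subsets n))
    ≡⟨ cong₂ _+_ (count-map (λ S → ∣ S ∣ ≟ k) (outside ∷_) (subsets n))
                 (count-map (λ S → ∣ S ∣ ≟ k) (inside ∷_) (subsets n)) ⟩
  count (λ S → ∣ S ∣ ≟ k) (subsets n) + count (λ S → suc ∣ S ∣ ≟ k) (subsets n)
    ≡⟨ cong (_+ count (λ S → suc ∣ S ∣ ≟ k) (subsets n)) (count-∣∣≡k n k) ⟩
  n C k + count (λ S → suc ∣ S ∣ ≟ k) (subsets n)
    ≡⟨ pascal k ⟩
  suc n C k ∎
  where
  open ≡-Reasoning
  -- Subsets without the first vertex and subsets with it give the two terms of Pascal's rule. Size
  -- 0 is separate: a subset that contains the first vertex is never empty, so only the term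
  -- `n C 0`, which computes to 1, remains.
  pascal : ∀ k → n C k + count (λ S → suc ∣ S ∣ ≟ k) (subsets n) ≡ suc n C k
  pascal zero    = cong₂ _+_ (refl {x = 1}) (count-none (λ S → suc ∣ S ∣ ≟ 0) (λ _ ()) (subsets n))
  pascal (suc k) = begin
    n C suc k + count (λ S → suc ∣ S ∣ ≟ suc k) (subsets n)
      ≡⟨ cong (n C suc k +_) (count-≐ (λ S → suc ∣ S ∣ ≟ suc k) (λ S → ∣ S ∣ ≟ k)
           (λ _ → suc-injective) (λ _ → cong suc) (subsets n)) ⟩
    n C suc k + count (λ S → ∣ S ∣ ≟ k) (subsets n)
      ≡⟨ cong (n C suc k +_) (count-∣∣≡k n k) ⟩
    n C suc k + n C k
      ≡⟨ +-comm (n C suc k) (n C k) ⟩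
    n C k + n C suc k
      ≡⟨ nCk+nC[k+1]≡[n+1]C[k+1] n k ⟩
    suc n C suc k ∎

-- Serves to bound a union of three singletons by 3 without a case split on which of the points
-- coincide.
∣p∪q∣≤∣p∣+∣q∣ : ∀ {n} (p q : Subset n) → ∣ p ∪ q ∣ ≤ ∣ p ∣ + ∣ q ∣
∣p∪q∣≤∣p∣+∣q∣ [] [] = z≤n
∣p∪q∣≤∣p∣+∣q∣ (outside ∷ p) (outside ∷ q) = ∣p∪q∣≤∣p∣+∣q∣ p q
∣p∪q∣≤∣p∣+∣q∣ (outside ∷ p) (inside ∷ q) rewrite +-suc ∣ p ∣ ∣ q ∣ = s≤s (∣p∪q∣≤∣p∣+∣q∣ p q)
∣p∪q∣≤∣p∣+∣q∣ (inside ∷ p) (outside ∷ q) = s≤s (∣p∪q∣≤∣p∣+∣q∣ p q)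
∣p∪q∣≤∣p∣+∣q∣ (inside ∷ p) (inside ∷ q) rewrite +-suc ∣ p ∣ ∣ q ∣ =
  s≤s (m≤n⇒m≤1+n (∣p∪q∣≤∣p∣+∣q∣ p q))

count-∈ : ∀ {n} (S : Subset n) → count (_∈? S) (allFin n) ≡ ∣ S ∣
count-∈ [] = refl
count-∈ {suc n} (outside ∷ S) = begin
  count (_∈? (outside ∷ S)) (allFin (suc n))  ≡⟨ count-allFin-suc (_∈? (outside ∷ S)) (λ ()) ⟩
  count (λ i → suc i ∈? (outside ∷ S)) (allFin n)
    ≡⟨ count-≐ _ (_∈? S) (λ _ → drop-there) (λ _ → there) (allFin n) ⟩
  count (_∈? S) (allFin n)                    ≡⟨ count-∈ S ⟩
  ∣ S ∣                                       ∎
  where open ≡-Reasoning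
count-∈ {suc n} (inside ∷ S) = cong suc (begin
  count (_∈? (inside ∷ S)) (tabulate suc)
    ≡⟨ cong (count (_∈? (inside ∷ S))) (map-tabulate id suc) ⟨
  count (_∈? (inside ∷ S)) (map suc (allFin n))
    ≡⟨ count-map (_∈? (inside ∷ S)) suc (allFin n) ⟩
  count (λ i → suc i ∈? (inside ∷ S)) (allFin n)
    ≡⟨ count-≐ _ (_∈? S) (λ _ → drop-there) (λ _ → there) (allFin n) ⟩
  count (_∈? S) (allFin n)
    ≡⟨ count-∈ S ⟩
  ∣ S ∣ ∎)
  where open ≡-Reasoning

pairs : ∀ n → List (Fin n × Fin n)
pairs n = cartesianProduct (allFin n) (allFin n)

IncreasingPairIn : ∀ {n} → Subset n → Fin n × Fin n → Set
IncreasingPairIn S (u , v) = u Fin.< v × u ∈ S × v ∈ S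

increasingPairIn? : ∀ {n} (S : Subset n) → Decidable (IncreasingPairIn S)
increasingPairIn? S (u , v) = (u Fin.<? v) ×-dec (u ∈? S) ×-dec (v ∈? S)

-- Induction on the vertex set. Row zero holds the pairs that start at the first vertex: none if it
-- is outside, one for each element of `S` if it is inside. The other rows reproduce the pairs of
-- `S`, and `suc-C2` adds the two contributions.
count-increasingPairs : ∀ {n} (S : Subset n) → count (increasingPairIn? S) (pairs n) ≡ ∣ S ∣ C 2
count-increasingPairs [] = refl
count-increasingPairs {suc n} (s ∷ S) = begin
  count (increasingPairIn? (s ∷ S)) (pairs (suc n))
    ≡⟨ count-cartesianProduct (increasingPairIn? (s ∷ S)) (allFin (suc n)) (allFin (suc n)) ⟩
  sum (map row (allFin (suc n)))
    ≡⟨ cong (sum ∘ map row) (allFin-suc n) ⟩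
  row zero + sum (map row (map suc (allFin n)))
    ≡⟨ cong (λ rows → row zero + sum rows) (sym (map-∘ (allFin n))) ⟩
  row zero + sum (map (λ u → row (suc u)) (allFin n))
    ≡⟨ cong (λ rows → row zero + sum rows) (map-cong row-suc (allFin n)) ⟩
  row zero + sum (map (λ u → count (λ v → increasingPairIn? S (u , v)) (allFin n)) (allFin n))
    ≡⟨ cong (row zero +_) (count-cartesianProduct (increasingPairIn? S) (allFin n) (allFin n)) ⟨
  row zero + count (increasingPairIn? S) (pairs n)
    ≡⟨ cong (row zero +_) (count-increasingPairs S) ⟩
  row zero + ∣ S ∣ C 2
    ≡⟨ row-zero s ⟩
  ∣ s ∷ S ∣ C 2 ∎
  where
  open ≡-Reasoning

  row : Fin (suc n) → ℕ
  row u = count (λ v → increasingPairIn? (s ∷ S) (u , v)) (allFin (suc n))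

  row-suc : ∀ u → row (suc u) ≡ count (λ v → increasingPairIn? S (u , v)) (allFin n)
  row-suc u = trans
    -- Column zero is empty in these rows, since no `suc u` lies below `zero`.
    (count-allFin-suc (λ v → increasingPairIn? (s ∷ S) (suc u , v)) λ ())
    (count-≐ _ (λ v → increasingPairIn? S (u , v))
      (λ { _ (s<s u<v , u∈ , v∈) → u<v , drop-there u∈ , drop-there v∈ })
      (λ { _ (u<v , u∈ , v∈) → s<s u<v , there u∈ , there v∈ })
      (allFin n))

  row-zero : ∀ s → count (λ v → increasingPairIn? (s ∷ S) (zero , v)) (allFin (suc n)) + ∣ S ∣ C 2
                   ≡ ∣ s ∷ S ∣ C 2
  row-zero outside = cong (_+ ∣ S ∣ C 2)
    (count-none (λ v → increasingPairIn? (outside ∷ S) (zero , v)) (λ { _ (_ , () , _) })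
      (allFin (suc n)))
  row-zero inside = begin
    count (λ v → increasingPairIn? (inside ∷ S) (zero , v)) (allFin (suc n)) + ∣ S ∣ C 2
      ≡⟨ cong (_+ ∣ S ∣ C 2)
           (count-allFin-suc (λ v → increasingPairIn? (inside ∷ S) (zero , v)) λ ()) ⟩
    count (λ v → increasingPairIn? (inside ∷ S) (zero , suc v)) (allFin n) + ∣ S ∣ C 2
      ≡⟨ cong (_+ ∣ S ∣ C 2) (count-≐ _ (_∈? S)
           (λ { _ (_ , _ , v∈) → drop-there v∈ }) (λ _ v∈ → z<s , here , there v∈) (allFin n)) ⟩
    count (_∈? S) (allFin n) + ∣ S ∣ C 2
      ≡⟨ cong (_+ ∣ S ∣ C 2) (count-∈ S) ⟩
    ∣ S ∣ + ∣ S ∣ C 2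
      ≡⟨ suc-C2 ∣ S ∣ ⟨
    suc ∣ S ∣ C 2 ∎

-- Induced edges in a graph and in its complement.

module _ {n : ℕ} (G : Graph n) where
  open Graph G

  size : Subset n → ℕ
  size S = length (inducedEdges G S)

  -- An edge is listed only in its increasing orientation, so `u` and `v` have to be compared before
  -- the list entry can be named.
  size-positive : ∀ {u v} {S : Subset n} → u ~ v → u ∈ S → v ∈ S → 0 < size S
  size-positive {u} {v} {S} u~v u∈S v∈S with Fin.<-cmp u v
  ... | tri< u<v _ _ = ∈-length (∈-filter⁺ _
          (∈-filter⁺ _ (∈-cartesianProduct⁺ (∈-allFin u) (∈-allFin v)) (u<v , u~v)) (u∈S , v∈S))
  ... | tri≈ _ u≡v _ = contradiction u~v (~-irrefl u≡v)
  ... | tri> _ _ v<u = ∈-length (∈-filter⁺ _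
          (∈-filter⁺ _ (∈-cartesianProduct⁺ (∈-allFin v) (∈-allFin u)) (v<u , ~-sym u~v))
          (v∈S , u∈S))

module _ {n : ℕ} (G : Graph n) where
  open Graph G

  private
    Ḡ = complement G
    module Ḡ = Graph Ḡ

  -- Once the nested filters are merged, both sides count pairs from the same list, and every
  -- increasing pair inside `S` is an edge of exactly one of the two graphs.
  size+size-complement : ∀ S → size G S + size Ḡ S ≡ ∣ S ∣ C 2
  size+size-complement S = begin
    size G S + size Ḡ S
      ≡⟨ cong₂ _+_ (count-filter _ _ (pairs n)) (count-filter _ _ (pairs n)) ⟩
    count inG? (pairs n) + count inḠ? (pairs n)
      ≡⟨ count-⊎ inG? inḠ? (λ { _ ((_ , u~v) , _) ((_ , _ , u≁v) , _) → u≁v u~v }) (pairs n) ⟨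
    count (λ e → inG? e ⊎-dec inḠ? e) (pairs n)
      ≡⟨ count-≐ (λ e → inG? e ⊎-dec inḠ? e) (increasingPairIn? S) to from (pairs n) ⟩
    count (increasingPairIn? S) (pairs n)
      ≡⟨ count-increasingPairs S ⟩
    ∣ S ∣ C 2 ∎
    where
    open ≡-Reasoning

    InG InḠ : Fin n × Fin n → Set
    InG (u , v) = (u Fin.< v × u ~ v) × (u ∈ S × v ∈ S)
    InḠ (u , v) = (u Fin.< v × u Ḡ.~ v) × (u ∈ S × v ∈ S)

    inG? : Decidable InG
    inG? (u , v) = ((u Fin.<? v) ×-dec (u ~? v)) ×-dec ((u ∈? S) ×-dec (v ∈? S))

    inḠ? : Decidable InḠ
    inḠ? (u , v) = ((u Fin.<? v) ×-dec (u Ḡ.~? v)) ×-dec ((u ∈? S) ×-dec (v ∈? S))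

    to : ∀ e → InG e ⊎ InḠ e → IncreasingPairIn S e
    to _ (inj₁ ((u<v , _) , uv∈S)) = u<v , uv∈S
    to _ (inj₂ ((u<v , _) , uv∈S)) = u<v , uv∈S

    from : ∀ e → IncreasingPairIn S e → InG e ⊎ InḠ e
    from (u , v) (u<v , uv∈S) with u ~? v
    ... | yes u~v = inj₁ ((u<v , u~v) , uv∈S)
    ... | no  u≁v = inj₂ ((u<v , Fin.<⇒≢ u<v , u≁v) , uv∈S)

  -- Exceptional subsets as the excess over the bound.

  Exceptional : Subset n → Set
  Exceptional S = (OneNearlyIndependent G S ⊎ OneNearlyIndependent Ḡ S) × ∣ S ∣ ≢ 2

  exceptional? : Decidable Exceptional
  exceptional? S =
    (oneNearlyIndependent? G S ⊎-dec oneNearlyIndependent? Ḡ S) ×-dec ¬? (∣ S ∣ ≟ 2)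

  σ₁+σ₁-complement : σ₁ G + σ₁ Ḡ ≡ (n * (n ∸ 1)) / 2 + count exceptional? (subsets n)
  σ₁+σ₁-complement = begin
    σ₁ G + σ₁ Ḡ
      ≡⟨ count-⊎ (oneNearlyIndependent? G) (oneNearlyIndependent? Ḡ) disjoint (subsets n) ⟨
    count (λ S → oneNearlyIndependent? G S ⊎-dec oneNearlyIndependent? Ḡ S) (subsets n)
      ≡⟨ count-≐ (λ S → oneNearlyIndependent? G S ⊎-dec oneNearlyIndependent? Ḡ S)
           (λ S → (∣ S ∣ ≟ 2) ⊎-dec exceptional? S) to from (subsets n) ⟩
    count (λ S → (∣ S ∣ ≟ 2) ⊎-dec exceptional? S) (subsets n)
      ≡⟨ count-⊎ (λ S → ∣ S ∣ ≟ 2) exceptional? (λ { _ ∣S∣≡2 (_ , ∣S∣≢2) → ∣S∣≢2 ∣S∣≡2 })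
           (subsets n) ⟩
    count (λ S → ∣ S ∣ ≟ 2) (subsets n) + count exceptional? (subsets n)
      ≡⟨ cong (_+ count exceptional? (subsets n)) (trans (count-∣∣≡k n 2) (C2≡half n)) ⟩
    (n * (n ∸ 1)) / 2 + count exceptional? (subsets n) ∎
    where
    open ≡-Reasoning

    disjoint : ∀ S → OneNearlyIndependent G S → ¬ OneNearlyIndependent Ḡ S
    disjoint S e ē = C2≢2 ∣ S ∣ (trans (sym (size+size-complement S)) (cong₂ _+_ e ē))

    sum≡1 : ∀ {a b} → a + b ≡ 1 → a ≡ 1 ⊎ b ≡ 1
    sum≡1 {zero}        eq = inj₂ eq
    sum≡1 {suc zero}    eq = inj₁ refl

    to : ∀ S → OneNearlyIndependent G S ⊎ OneNearlyIndependent Ḡ S → ∣ S ∣ ≡ 2 ⊎ Exceptional S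
    to S one with ∣ S ∣ ≟ 2
    ... | yes ∣S∣≡2 = inj₁ ∣S∣≡2
    ... | no  ∣S∣≢2 = inj₂ (one , ∣S∣≢2)

    from : ∀ S → ∣ S ∣ ≡ 2 ⊎ Exceptional S → OneNearlyIndependent G S ⊎ OneNearlyIndependent Ḡ S
    -- For a subset of size 2 the two edge counts add up to `2 C 2`, which is 1.
    from S (inj₁ ∣S∣≡2)     = sum≡1 (trans (size+size-complement S) (cong (_C 2) ∣S∣≡2))
    from S (inj₂ (one , _)) = one

  -- Both edge counts are positive, and their sum is at most `3 C 2`, which is 3; hence one of them
  -- is 1. The sum is also at least 2, which rules out size 2, where it would be 1.
  mixed-vertex⇒exceptional : ∀ {w u v} → w ~ u → w Ḡ.~ v → Exceptional (⁅ w ⁆ ∪ (⁅ u ⁆ ∪ ⁅ v ⁆))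
  mixed-vertex⇒exceptional {w} {u} {v} w~u w≁v = one , ∣S∣≢2
    where
    open ≤-Reasoning
    S = ⁅ w ⁆ ∪ (⁅ u ⁆ ∪ ⁅ v ⁆)

    w∈S : w ∈ S
    w∈S = x∈p∪q⁺ (inj₁ (x∈⁅x⁆ w))

    u∈S : u ∈ S
    u∈S = x∈p∪q⁺ (inj₂ (x∈p∪q⁺ (inj₁ (x∈⁅x⁆ u))))

    v∈S : v ∈ S
    v∈S = x∈p∪q⁺ {p = ⁅ w ⁆} (inj₂ (x∈p∪q⁺ {p = ⁅ u ⁆} (inj₂ (x∈⁅x⁆ v))))

    0<size : 0 < size G S
    0<size = size-positive G w~u w∈S u∈S

    0<size-complement : 0 < size Ḡ S
    0<size-complement = size-positive Ḡ w≁v w∈S v∈S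

    ∣S∣≤3 : ∣ S ∣ ≤ 3
    ∣S∣≤3 = begin
      ∣ S ∣                                 ≤⟨ ∣p∪q∣≤∣p∣+∣q∣ ⁅ w ⁆ (⁅ u ⁆ ∪ ⁅ v ⁆) ⟩
      ∣ ⁅ w ⁆ ∣ + ∣ ⁅ u ⁆ ∪ ⁅ v ⁆ ∣         ≤⟨ +-mono-≤ (≤-reflexive (∣⁅x⁆∣≡1 w)) (∣p∪q∣≤∣p∣+∣q∣ ⁅ u ⁆ ⁅ v ⁆) ⟩
      1 + (∣ ⁅ u ⁆ ∣ + ∣ ⁅ v ⁆ ∣)           ≡⟨ cong suc (cong₂ _+_ (∣⁅x⁆∣≡1 u) (∣⁅x⁆∣≡1 v)) ⟩
      3                                     ∎

    one-of : ∀ {a b} → 0 < a → 0 < b → a + b ≤ 3 → a ≡ 1 ⊎ b ≡ 1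
    one-of {suc zero}                    _ _ _ = inj₁ refl
    one-of {suc (suc a)} {suc zero}      _ _ _ = inj₂ refl
    one-of {suc (suc a)} {suc (suc b)}   _ _ (s≤s (s≤s a+2+b≤1))
      -- If both counts were at least 2, then `a + suc (suc b) ≤ 1` would remain; moving the two
      -- successors outward exposes the contradiction.
      with s≤s () ← subst (_≤ 1) (trans (+-suc a (suc b)) (cong suc (+-suc a b))) a+2+b≤1

    one : OneNearlyIndependent G S ⊎ OneNearlyIndependent Ḡ S
    one = one-of 0<size 0<size-complement
            (subst (_≤ 3) (sym (size+size-complement S)) (C2≤3 ∣S∣≤3))

    ∣S∣≢2 : ∣ S ∣ ≢ 2
    ∣S∣≢2 ∣S∣≡2 = contradiction
      (subst (2 ≤_) (trans (size+size-complement S) (cong (_C 2) ∣S∣≡2))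
        (+-mono-≤ 0<size 0<size-complement))
      λ { (s≤s ()) }

  -- Compare `a`, an end of the edge, with `x`, an end of the non-edge. If they are equal, this
  -- vertex is mixed. If they are adjacent, `x` has neighbour `a` and non-neighbour `y`. Otherwise
  -- `a` has neighbour `b` and non-neighbour `x`.
  mixed-vertex : ∀ {a b x y} → a ~ b → x Ḡ.~ y → ∃[ w ] ∃[ u ] ∃[ v ] (w ~ u × w Ḡ.~ v)
  mixed-vertex {a} {b} {x} {y} a~b x≁y with a Fin.≟ x | a ~? x
  ... | yes refl | _       = a , b , y , a~b , x≁y
  ... | no  _    | yes a~x = x , a , y , ~-sym a~x , x≁y
  ... | no  a≢x  | no a≁x  = a , b , x , a~b , a≢x , a≁x

-- Complete and edgeless graphs.

infix 4 _≈_

-- Isomorphism along the identity. For complete and edgeless graphs every isomorphism reduces to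
-- this case, so `σ₁` never has to be transported along a general permutation.
_≈_ : ∀ {n} → Graph n → Graph n → Set
G ≈ H = ∀ u v → (u G.~ v) ⇔ (u H.~ v)
  where
  module G = Graph G
  module H = Graph H

module _ {n : ℕ} (G H : Graph n) where

  ≈⇒≅ : G ≈ H → G ≅ H
  ≈⇒≅ G≈H = record { bijection = Permutation.id ; adjacency = G≈H }

  σ₁-cong : G ≈ H → σ₁ G ≡ σ₁ H
  σ₁-cong G≈H = cong length (filter-≐ (oneNearlyIndependent? G) (oneNearlyIndependent? H)
      ((λ {S} → trans (sym (size-cong S))) , (λ {S} → trans (size-cong S))) (subsets n))
    where
    size-cong : ∀ S → size G S ≡ size H S
    size-cong S = cong (λ es → length (filter (λ (u , v) → (u ∈? S) ×-dec (v ∈? S)) es))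
      (filter-≐ _ _
        ( (λ {(u , v)} (u<v , u~v) → u<v , Equivalence.to (G≈H u v) u~v)
        , (λ {(u , v)} (u<v , u~v) → u<v , Equivalence.from (G≈H u v) u~v))
        (pairs n))

  complement-cong : G ≈ H → complement G ≈ complement H
  complement-cong G≈H u v = mk⇔
    (λ (u≢v , u≁v) → u≢v , u≁v ∘ Equivalence.from (G≈H u v))
    (λ (u≢v , u≁v) → u≢v , u≁v ∘ Equivalence.to (G≈H u v))

complement-complement-K : ∀ n → complement (complement (K n)) ≈ K n
complement-complement-K n u v = mk⇔ proj₁ (λ u≢v → u≢v , λ (_ , ¬u≢v) → ¬u≢v u≢v)

module _ {n : ℕ} {G : Graph n} where

  -- Adjacency in `K n` is distinctness, which a bijection both preserves and reflects.
  ≅K⇒≈K : G ≅ K n → G ≈ K n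
  ≅K⇒≈K G≅K u v = mk⇔
    (λ u~v u≡v → Equivalence.to (adjacency u v) u~v (cong (bijection ⟨$⟩ʳ_) u≡v))
    (λ u≢v → Equivalence.from (adjacency u v) (u≢v ∘ Injection.injective (↔⇒↣ bijection)))
    where open _≅_ G≅K

  ≅complement-K⇒≈complement-K : G ≅ complement (K n) → G ≈ complement (K n)
  ≅complement-K⇒≈complement-K G≅K̄ u v = mk⇔
    (λ u~v → let (p , ¬p) = Equivalence.to (adjacency u v) u~v in contradiction p ¬p)
    (λ (u≢v , ¬u≢v) → contradiction u≢v ¬u≢v)
    where open _≅_ G≅K̄

size-edgeless : ∀ {n} (S : Subset n) → size (complement (K n)) S ≡ 0
size-edgeless {n} S = trans (count-filter _ _ (pairs n))
  (count-none _ (λ { _ ((_ , u≢v , ¬u≢v) , _) → ¬u≢v u≢v }) (pairs n))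

σ₁-edgeless : ∀ n → σ₁ (complement (K n)) ≡ 0
σ₁-edgeless n = count-none (oneNearlyIndependent? (complement (K n)))
  (λ S one → contradiction (trans (sym (size-edgeless S)) one) λ ()) (subsets n)

-- A subset of size k spans `k C 2` edges of `K n`, and this number is 1 exactly when k is 2.
σ₁-K : ∀ n → σ₁ (K n) ≡ (n * (n ∸ 1)) / 2
σ₁-K n = begin
  σ₁ (K n)
    ≡⟨ count-≐ (oneNearlyIndependent? (K n)) (λ S → ∣ S ∣ ≟ 2)
         (λ S one → C2≡1⇒≡2 ∣ S ∣ (trans (sym (size-K S)) one))
         (λ S ∣S∣≡2 → trans (size-K S) (cong (_C 2) ∣S∣≡2)) (subsets n) ⟩
  count (λ S → ∣ S ∣ ≟ 2) (subsets n)
    ≡⟨ count-∣∣≡k n 2 ⟩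
  n C 2
    ≡⟨ C2≡half n ⟩
  (n * (n ∸ 1)) / 2 ∎
  where
  open ≡-Reasoning

  size-K : ∀ S → size (K n) S ≡ ∣ S ∣ C 2
  -- The complement contributes no edges, so the identity for the two sizes gives this count
  -- directly.
  size-K S = begin
    size (K n) S                                  ≡⟨ +-identityʳ _ ⟨
    size (K n) S + 0                              ≡⟨ cong (size (K n) S +_) (size-edgeless S) ⟨
    size (K n) S + size (complement (K n)) S      ≡⟨ size+size-complement (K n) S ⟩
    ∣ S ∣ C 2                                     ∎

-- The case of equality.

module _ {n : ℕ} (G : Graph n) where
  open Graph G

  private
    Ḡ = complement G
    module Ḡ = Graph Ḡ

  no-exceptional⇒≅ : count (exceptional? G) (subsets n) ≡ 0 → (G ≅ K n) ⊎ (G ≅ complement (K n))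
  -- Finiteness makes the existence of an edge and of a non-edge decidable, which provides the case
  -- split.
  no-exceptional⇒≅ none with Fin.any? (λ u → Fin.any? λ v → u ~? v)
                            | Fin.any? (λ u → Fin.any? λ v → u Ḡ.~? v)
  ... | no edgeless | _ = inj₂ (≈⇒≅ G (complement (K n)) λ u v → mk⇔
          (λ u~v → contradiction (u , v , u~v) edgeless)
          (λ (u≢v , ¬u≢v) → contradiction u≢v ¬u≢v))
  ... | yes _ | no complete = inj₁ (≈⇒≅ G (K n) λ u v → mk⇔
          (λ u~v u≡v → ~-irrefl u≡v u~v)
          -- The absence of non-edges only refutes non-adjacency; decidability of adjacency turns
          -- this into an edge.
          (λ u≢v → decidable-stable (u ~? v) λ u≁v → complete (u , v , u≢v , u≁v)))
  ... | yes (_ , _ , a~b) | yes (_ , _ , x≁y) =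
    let (w , u , v , w~u , w≁v) = mixed-vertex G a~b x≁y
        exceptional = mixed-vertex⇒exceptional G {w} {u} {v} w~u w≁v
    in contradiction (sym none)
         -- The exceptional set occurs in `subsets n`, so the count assumed to be 0 is positive.
         (<⇒≢ (∈-length (∈-filter⁺ (exceptional? G) (subsets-complete _) exceptional)))

  ≅⇒equality : (G ≅ K n) ⊎ (G ≅ complement (K n)) → σ₁ G + σ₁ Ḡ ≡ (n * (n ∸ 1)) / 2
  ≅⇒equality (inj₁ G≅K) = begin
    σ₁ G + σ₁ Ḡ
      ≡⟨ cong₂ _+_ (σ₁-cong G (K n) G≈K)
         (σ₁-cong Ḡ (complement (K n)) (complement-cong G (K n) G≈K)) ⟩
    σ₁ (K n) + σ₁ (complement (K n))
      ≡⟨ cong₂ _+_ (σ₁-K n) (σ₁-edgeless n) ⟩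
    (n * (n ∸ 1)) / 2 + 0
      ≡⟨ +-identityʳ _ ⟩
    (n * (n ∸ 1)) / 2 ∎
    where
    open ≡-Reasoning
    G≈K : G ≈ K n
    G≈K = ≅K⇒≈K G≅K
  ≅⇒equality (inj₂ G≅K̄) = begin
    σ₁ G + σ₁ Ḡ
      ≡⟨ cong₂ _+_ (σ₁-cong G K̄ G≈K̄) (σ₁-cong Ḡ (complement K̄) (complement-cong G K̄ G≈K̄)) ⟩
    σ₁ K̄ + σ₁ (complement K̄)
      ≡⟨ cong₂ _+_ (σ₁-edgeless n) (σ₁-cong (complement K̄) (K n) (complement-complement-K n)) ⟩
    σ₁ (K n)
      ≡⟨ σ₁-K n ⟩
    (n * (n ∸ 1)) / 2 ∎
    where
    open ≡-Reasoning
    K̄ = complement (K n)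
    G≈K̄ : G ≈ K̄
    G≈K̄ = ≅complement-K⇒≈complement-K G≅K̄

theorem2 : ∀ (n : ℕ) .{{_ : NonZero n}} (G : Graph n) →
    (σ₁ G + σ₁ (complement G) ≥ (n * (n ∸ 1)) / 2)
    × ((σ₁ G + σ₁ (complement G) ≡ (n * (n ∸ 1)) / 2) ⇔ ((G ≅ K n) ⊎ (G ≅ complement (K n))))
theorem2 n G =
    subst (half ≤_) (sym (σ₁+σ₁-complement G)) (m≤m+n half _)
  , mk⇔
      -- Equality reads `half` plus the exceptional count equals `half + 0`; cancelling `half` makes
      -- that count 0.
      (λ eq → no-exceptional⇒≅ G (+-cancelˡ-≡ half _ 0
        (trans (sym (σ₁+σ₁-complement G)) (trans eq (sym (+-identityʳ half))))))
      (≅⇒equality G)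
  where half = (n * (n ∸ 1)) / 2
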